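{- Let $\lambda>0$ and $\mu$ be real numbers, and let $C_4$ be the cycle on $4$ vertices. The multiset $\{0, \lambda,\lambda, \mu\}$ is Laplacian realizable for $C_4$ if and only if $\mu \geq 2\lambda$.
   Context: For a finite simple graph $G$ on $n$ vertices, $\mathcal{S}_L(G)$ denotes the set of $n\times n$ real symmetric matrices $A=[a_{i,j}]$ such that $a_{i,j}<0$ if $\{i,j\}\in E(G)$, $a_{i,j}=0$ if $i\neq j$ and $\{i,j\}\notin E(G)$, and $a_{i,i}=-\sum_{k\neq i}a_{i,k}$ for all $i$. A multiset of $n$ real numbers is Laplacian realizable for $G$ if it is the spectrum (multiset of eigenvalues) of some $A\in\mathcal{S}_L(G)$. -}

module Defs where

open import Algebra.Bundles.Raw using (RawRing)
import Algebra.Definitions.RawMonoid as RawMonoidDefs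
import Algebra.Definitions.RawSemiring as RawSemiringDefs
open import Data.Bool.Base using (if_then_else_)
open import Data.Fin.Base using (Fin; zero; suc; toℕ; punchIn)
import Data.Fin.Properties as Fin
open import Data.Nat.Base as ℕ using (ℕ; zero; suc; _⊔_)
import Data.Nat.DivMod as ℕ
import Data.Nat.Properties as ℕ
open import Data.Product.Base using (∃-syntax; _×_; _,_)
open import Data.Rational.Base as ℚ using (ℚ; 0ℚ; 1ℚ; ½; ∣_∣)
import Data.Rational.Properties as ℚ
open import Data.Rational.Solver using (module +-*-Solver)
open import Data.Sum.Base using (_⊎_; inj₁; inj₂; swap)
open import Data.Vec.Base using (Vec; lookup)
open import Level using (0ℓ)
open import Relation.Binary.PropositionalEquality
  using (_≡_; refl; sym; trans; cong; subst)
open import Relation.Nullary.Decidable using (⌊_⌋; Dec; _⊎-dec_)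
open import Relation.Nullary.Negation using (¬_)

-- Real numbers are Cauchy sequences of rationals; the quotient by null
-- sequences is replaced by the setoid equality _≈_.

IsCauchy : (ℕ → ℚ) → Set
IsCauchy x = ∀ ε → 0ℚ ℚ.< ε →
  ∃[ N ] (∀ m n → N ℕ.≤ m → N ℕ.≤ n → ∣ x m ℚ.- x n ∣ ℚ.< ε)

record ℝ : Set where
  constructor mkℝ
  field
    seq    : ℕ → ℚ
    cauchy : IsCauchy seq

open ℝ public

infix 4 _≈_ _<_ _≤_ _≥_

record _≈_ (x y : ℝ) : Set where
  constructor mk≈
  field
    bound≈ : ∀ ε → 0ℚ ℚ.< ε →
      ∃[ N ] (∀ n → N ℕ.≤ n → ∣ seq x n ℚ.- seq y n ∣ ℚ.< ε)

record _<_ (x y : ℝ) : Set where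
  constructor mk<
  field
    bound< : ∃[ ε ] (0ℚ ℚ.< ε ×
      ∃[ N ] (∀ n → N ℕ.≤ n → seq x n ℚ.+ ε ℚ.< seq y n))

record _≤_ (x y : ℝ) : Set where
  constructor mk≤
  field
    bound≤ : ∀ ε → 0ℚ ℚ.< ε →
      ∃[ N ] (∀ n → N ℕ.≤ n → seq x n ℚ.< seq y n ℚ.+ ε)

open _≈_ public
open _<_ public
open _≤_ public

_≥_ : ℝ → ℝ → Set
x ≥ y = y ≤ x

private abstract
  0<ε*½ : ∀ {ε} → 0ℚ ℚ.< ε → 0ℚ ℚ.< ε ℚ.* ½
  0<ε*½ {ε} 0<ε = subst (ℚ._< ε ℚ.* ½) (ℚ.*-zeroˡ ½) (ℚ.*-monoˡ-<-pos ½ 0<ε)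

  halves : ∀ ε → ε ℚ.* ½ ℚ.+ ε ℚ.* ½ ≡ ε
  halves ε = trans (sym (ℚ.*-distribˡ-+ ε ½ ½)) (ℚ.*-identityʳ ε)

  ∣neg∣ : ∀ p q → ∣ ℚ.- p ℚ.- ℚ.- q ∣ ≡ ∣ p ℚ.- q ∣
  ∣neg∣ p q = trans (cong ∣_∣ (sym (ℚ.neg-distrib-+ p (ℚ.- q)))) (ℚ.∣-p∣≡∣p∣ (p ℚ.- q))

  +-rearrange : ∀ a b c d →
    (a ℚ.+ b) ℚ.- (c ℚ.+ d) ≡ (a ℚ.- c) ℚ.+ (b ℚ.- d)
  +-rearrange = solve 4 (λ a b c d →
    (a :+ b) :+ (:- (c :+ d)) := (a :+ (:- c)) :+ (b :+ (:- d))) refl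
    where open +-*-Solver

  *-rearrange : ∀ a b c d →
    a ℚ.* b ℚ.- c ℚ.* d ≡ a ℚ.* (b ℚ.- d) ℚ.+ d ℚ.* (a ℚ.- c)
  *-rearrange = solve 4 (λ a b c d →
    a :* b :+ (:- (c :* d)) := a :* (b :+ (:- d)) :+ d :* (a :+ (:- c))) refl
    where open +-*-Solver

  sub-add : ∀ a b → a ≡ b ℚ.+ (a ℚ.- b)
  sub-add = solve 2 (λ a b → a := b :+ (a :+ (:- b))) refl
    where open +-*-Solver

  const-cauchy : ∀ q → IsCauchy (λ _ → q)
  const-cauchy q ε 0<ε = 0 , λ _ _ _ _ →
    subst (ℚ._< ε) (sym (cong ∣_∣ (ℚ.+-inverseʳ q))) 0<ε

  neg-cauchy : ∀ x → IsCauchy x → IsCauchy (λ n → ℚ.- x n)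
  neg-cauchy x cx ε 0<ε with cx ε 0<ε
  ... | N , h = N , λ m n N≤m N≤n →
    subst (ℚ._< ε) (sym (∣neg∣ (x m) (x n))) (h m n N≤m N≤n)

  +-cauchy : ∀ x y → IsCauchy x → IsCauchy y → IsCauchy (λ n → x n ℚ.+ y n)
  +-cauchy x y cx cy ε 0<ε with cx (ε ℚ.* ½) (0<ε*½ 0<ε) | cy (ε ℚ.* ½) (0<ε*½ 0<ε)
  ... | M , f | N , g = M ⊔ N , λ m n M⊔N≤m M⊔N≤n → begin-strict
    ∣ (x m ℚ.+ y m) ℚ.- (x n ℚ.+ y n) ∣      ≡⟨ cong ∣_∣ (+-rearrange (x m) (y m) (x n) (y n)) ⟩
    ∣ (x m ℚ.- x n) ℚ.+ (y m ℚ.- y n) ∣      ≤⟨ ℚ.∣p+q∣≤∣p∣+∣q∣ (x m ℚ.- x n) (y m ℚ.- y n) ⟩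
    ∣ x m ℚ.- x n ∣ ℚ.+ ∣ y m ℚ.- y n ∣      <⟨ ℚ.+-mono-<
        (f m n (ℕ.m⊔n≤o⇒m≤o M N M⊔N≤m) (ℕ.m⊔n≤o⇒m≤o M N M⊔N≤n))
        (g m n (ℕ.m⊔n≤o⇒n≤o M N M⊔N≤m) (ℕ.m⊔n≤o⇒n≤o M N M⊔N≤n)) ⟩
    ε ℚ.* ½ ℚ.+ ε ℚ.* ½                      ≡⟨ halves ε ⟩
    ε                                        ∎
    where open ℚ.≤-Reasoning

  eventually-bounded : ∀ x → IsCauchy x →
    ∃[ B ] (ℚ.Positive B × ∃[ N ] (∀ n → N ℕ.≤ n → ∣ x n ∣ ℚ.≤ B))
  eventually-bounded x cx with cx 1ℚ (ℚ.positive⁻¹ 1ℚ)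
  ... | N , h = ∣ x N ∣ ℚ.+ 1ℚ
              , ℚ.nonNeg+pos⇒pos ∣ x N ∣ {{ℚ.∣-∣-nonNeg (x N)}} 1ℚ
              , N , λ n N≤n → begin
    ∣ x n ∣                        ≡⟨ cong ∣_∣ (sub-add (x n) (x N)) ⟩
    ∣ x N ℚ.+ (x n ℚ.- x N) ∣      ≤⟨ ℚ.∣p+q∣≤∣p∣+∣q∣ (x N) (x n ℚ.- x N) ⟩
    ∣ x N ∣ ℚ.+ ∣ x n ℚ.- x N ∣    ≤⟨ ℚ.+-monoʳ-≤ ∣ x N ∣ (ℚ.<⇒≤ (h n N N≤n ℕ.≤-refl)) ⟩
    ∣ x N ∣ ℚ.+ 1ℚ                 ∎
    where open ℚ.≤-Reasoning

  ∣*∣-bound : ∀ p q b d → ℚ.Positive b → ∣ p ∣ ℚ.≤ b → ∣ q ∣ ℚ.< d → ∣ p ℚ.* q ∣ ℚ.< b ℚ.* d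
  ∣*∣-bound p q b d b>0 p≤b q<d = begin-strict
    ∣ p ℚ.* q ∣        ≡⟨ ℚ.∣p*q∣≡∣p∣*∣q∣ p q ⟩
    ∣ p ∣ ℚ.* ∣ q ∣    ≤⟨ ℚ.*-monoʳ-≤-nonNeg ∣ q ∣ {{ℚ.∣-∣-nonNeg q}} p≤b ⟩
    b ℚ.* ∣ q ∣        <⟨ ℚ.*-monoʳ-<-pos b {{b>0}} q<d ⟩
    b ℚ.* d            ∎
    where open ℚ.≤-Reasoning

  *-difference : ∀ a b c d B C δ → ℚ.Positive B → ℚ.Positive C →
    ∣ a ∣ ℚ.≤ B → ∣ d ∣ ℚ.≤ C → ∣ a ℚ.- c ∣ ℚ.< δ → ∣ b ℚ.- d ∣ ℚ.< δ →
    ∣ a ℚ.* b ℚ.- c ℚ.* d ∣ ℚ.< (B ℚ.+ C) ℚ.* δ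
  *-difference a b c d B C δ B>0 C>0 a≤B d≤C a-c<δ b-d<δ = begin-strict
    ∣ a ℚ.* b ℚ.- c ℚ.* d ∣                            ≡⟨ cong ∣_∣ (*-rearrange a b c d) ⟩
    ∣ a ℚ.* (b ℚ.- d) ℚ.+ d ℚ.* (a ℚ.- c) ∣            ≤⟨ ℚ.∣p+q∣≤∣p∣+∣q∣ (a ℚ.* (b ℚ.- d)) (d ℚ.* (a ℚ.- c)) ⟩
    ∣ a ℚ.* (b ℚ.- d) ∣ ℚ.+ ∣ d ℚ.* (a ℚ.- c) ∣        <⟨ ℚ.+-mono-<
        (∣*∣-bound a (b ℚ.- d) B δ B>0 a≤B b-d<δ)
        (∣*∣-bound d (a ℚ.- c) C δ C>0 d≤C a-c<δ) ⟩
    B ℚ.* δ ℚ.+ C ℚ.* δ                                ≡⟨ ℚ.*-distribʳ-+ δ B C ⟨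
    (B ℚ.+ C) ℚ.* δ                                    ∎
    where open ℚ.≤-Reasoning

  divide : ∀ D {ε} → ℚ.Positive D → 0ℚ ℚ.< ε → ∃[ δ ] (0ℚ ℚ.< δ × D ℚ.* δ ≡ ε)
  divide D {ε} D>0 0<ε = go ((ℚ.1/ D) {{D≢0}}) (ℚ.1/pos⇒pos D {{D>0}}) (ℚ.*-inverseʳ D {{D≢0}})
    where
    D≢0 : ℚ.NonZero D
    D≢0 = ℚ.pos⇒nonZero D {{D>0}}

    go : ∀ r → ℚ.Positive r → D ℚ.* r ≡ 1ℚ → ∃[ δ ] (0ℚ ℚ.< δ × D ℚ.* δ ≡ ε)
    go r r>0 Dr≡1 = r ℚ.* ε
      , ℚ.positive⁻¹ (r ℚ.* ε) {{ℚ.pos*pos⇒pos r {{r>0}} ε {{ℚ.positive 0<ε}}}}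
      , trans (sym (ℚ.*-assoc D r ε)) (trans (cong (ℚ._* ε) Dr≡1) (ℚ.*-identityˡ ε))

  *-cauchy : ∀ x y → IsCauchy x → IsCauchy y → IsCauchy (λ n → x n ℚ.* y n)
  *-cauchy x y cx cy ε 0<ε =
    let B , B>0 , K , bx = eventually-bounded x cx
        C , C>0 , L , by = eventually-bounded y cy
        D>0 = ℚ.nonNeg+pos⇒pos B {{ℚ.pos⇒nonNeg B {{B>0}}}} C {{C>0}}
        δ , 0<δ , Dδ≡ε = divide (B ℚ.+ C) D>0 0<ε
        M , f = cx δ 0<δ
        N , g = cy δ 0<δ
    in (K ⊔ L) ⊔ (M ⊔ N) , λ m n p q →
    let M⊔N≤m = ℕ.m⊔n≤o⇒n≤o (K ⊔ L) (M ⊔ N) p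
        M⊔N≤n = ℕ.m⊔n≤o⇒n≤o (K ⊔ L) (M ⊔ N) q
    in subst (∣ x m ℚ.* y m ℚ.- x n ℚ.* y n ∣ ℚ.<_) Dδ≡ε
      (*-difference (x m) (y m) (x n) (y n) B C δ B>0 C>0
        (bx m (ℕ.m⊔n≤o⇒m≤o K L (ℕ.m⊔n≤o⇒m≤o (K ⊔ L) (M ⊔ N) p)))
        (by n (ℕ.m⊔n≤o⇒n≤o K L (ℕ.m⊔n≤o⇒m≤o (K ⊔ L) (M ⊔ N) q)))
        (f m n (ℕ.m⊔n≤o⇒m≤o M N M⊔N≤m) (ℕ.m⊔n≤o⇒m≤o M N M⊔N≤n))
        (g m n (ℕ.m⊔n≤o⇒n≤o M N M⊔N≤m) (ℕ.m⊔n≤o⇒n≤o M N M⊔N≤n)))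

infixl 6 _+_ _-_
infixl 7 _*_
infix  8 -_

fromℚ : ℚ → ℝ
fromℚ q = mkℝ (λ _ → q) (const-cauchy q)

0ℝ 1ℝ 2ℝ : ℝ
0ℝ = fromℚ 0ℚ
1ℝ = fromℚ 1ℚ
2ℝ = fromℚ (1ℚ ℚ.+ 1ℚ)

-_ : ℝ → ℝ
- x = mkℝ (λ n → ℚ.- seq x n) (neg-cauchy (seq x) (cauchy x))

_+_ _-_ _*_ : ℝ → ℝ → ℝ
x + y = mkℝ (λ n → seq x n ℚ.+ seq y n) (+-cauchy (seq x) (seq y) (cauchy x) (cauchy y))
x - y = x + (- y)
x * y = mkℝ (λ n → seq x n ℚ.* seq y n) (*-cauchy (seq x) (seq y) (cauchy x) (cauchy y))

ℝ-rawRing : RawRing 0ℓ 0ℓ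
ℝ-rawRing = record
  { Carrier = ℝ ; _≈_ = _≈_ ; _+_ = _+_ ; _*_ = _*_ ; -_ = -_ ; 0# = 0ℝ ; 1# = 1ℝ }

open RawMonoidDefs (RawRing.+-rawMonoid ℝ-rawRing) public using () renaming (sum to ∑)
open RawMonoidDefs (RawRing.*-rawMonoid ℝ-rawRing) public using () renaming (sum to ∏)
open RawSemiringDefs (RawRing.rawSemiring ℝ-rawRing) public using (_^_)

Matrix : ℕ → Set
Matrix n = Fin n → Fin n → ℝ

-- Laplace expansion along the first row.
det : ∀ {n} → Matrix n → ℝ
det {zero}  A = 1ℝ
det {suc n} A = ∑ λ j →
  (- 1ℝ) ^ toℕ j * (A zero j * det (λ i k → A (suc i) (punchIn j k)))

scalar : ∀ {n} → ℝ → Matrix n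
scalar x i j = if ⌊ i Fin.≟ j ⌋ then x else 0ℝ

charPoly : ∀ {n} → Matrix n → ℝ → ℝ
charPoly A x = det (λ i j → scalar x i j - A i j)

-- The eigenvalues listed in v, counted with algebraic multiplicity, are
-- all those of A: det (xI - A) = ∏ᵢ (x - vᵢ) as polynomial functions,
-- which over ℝ is the same as equality of polynomials.  The condition
-- does not depend on the order of v, so v stands for a multiset.
IsSpectrum : ∀ {n} → Vec ℝ n → Matrix n → Set
IsSpectrum v A = ∀ x → charPoly A x ≈ ∏ (λ i → x - lookup v i)

record SimpleGraph (n : ℕ) : Set₁ where
  field
    Adj     : Fin n → Fin n → Set
    adj?    : ∀ i j → Dec (Adj i j)
    symAdj  : ∀ {i j} → Adj i j → Adj j i
    irrefl  : ∀ {i} → ¬ Adj i i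

open SimpleGraph public

record S_L {n} (G : SimpleGraph n) (A : Matrix n) : Set where
  field
    symmetric : ∀ i j → A i j ≈ A j i
    edge      : ∀ i j → Adj G i j → A i j < 0ℝ
    nonEdge   : ∀ i j → ¬ (i ≡ j) → ¬ Adj G i j → A i j ≈ 0ℝ
    diagonal  : ∀ i → A i i ≈ - ∑ (λ k → if ⌊ k Fin.≟ i ⌋ then 0ℝ else A i k)

LaplacianRealizable : ∀ {n} → SimpleGraph n → Vec ℝ n → Set
LaplacianRealizable {n} G v = ∃[ A ] (S_L G A × IsSpectrum v A)

C₄ : SimpleGraph 4
C₄ = record
  { Adj    = λ i j → next i j ⊎ next j i
  ; adj?   = λ i j → next? i j ⊎-dec next? j i
  ; symAdj = swap
  ; irrefl = λ { {i} (inj₁ e) → noLoop i e ; {i} (inj₂ e) → noLoop i e }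
  }
  where
  next : Fin 4 → Fin 4 → Set
  next i j = toℕ j ≡ suc (toℕ i) ℕ.% 4

  next? : ∀ i j → Dec (next i j)
  next? i j = toℕ j ℕ.≟ suc (toℕ i) ℕ.% 4

  noLoop : ∀ i → ¬ next i i
  noLoop zero                   ()
  noLoop (suc zero)             ()
  noLoop (suc (suc zero))       ()
  noLoop (suc (suc (suc zero))) ()

{-# OPTIONS --safe #-}
module Submission where

-- On the orthogonal complement of the all-ones vector, in the basis
-- (1,1,-1,-1)/2, (1,-1,1,-1)/2, (1,-1,-1,1)/2, the Laplacian of C₄ with edge
-- weights a, b, c, d (in cyclic order) is the tridiagonal matrix
--
--     M = [[Q, u, 0], [u, P+Q, v], [0, v, P]],
--     P = a+c,  Q = b+d,  u = d-b,  v = a-c.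
--
-- If λ is a double root of the characteristic polynomial of M, then the
-- adjugate N of λI - M satisfies tr N = 0 and e₂(N) = det(λI - M) tr(λI - M) = 0,
-- so the symmetric matrix N has tr N² = 0 and vanishes.  Its diagonal entries
-- give PQ(P+Q-2λ) = Qv² + Pu² ≥ 0, while the trace gives μ = 2(P+Q-λ).
-- Conversely b = d = λ/2 and a, c = (μ ± √(μ(μ-2λ)))/4 realize the spectrum.

open import Defs
open import Algebra.Bundles.Raw using (RawRing)
import Algebra.Definitions.RawMonoid as RawMonoidDefs
import Algebra.Definitions.RawSemiring as RawSemiringDefs
open import Data.Bool.Base using (if_then_else_)
open import Data.Fin.Base using (Fin; zero; suc; toℕ; punchIn)
open import Data.Fin.Patterns using (0F; 1F; 2F; 3F)
import Data.Fin.Properties as Fin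
open import Data.Integer.Base as ℤ using (+_; -[1+_])
import Data.Integer.Properties as ℤ
open import Data.Nat.Base as ℕ using (ℕ; zero; suc; _⊔_)
import Data.Nat.Coprimality as ℕ
import Data.Nat.Properties as ℕ
open import Data.Product.Base using (∃-syntax; _×_; _,_; proj₁; proj₂)
open import Data.Rational.Base as ℚ using (ℚ; mkℚ; 0ℚ; 1ℚ; ½; ∣_∣)
import Data.Rational.Properties as ℚ
open import Data.Rational.Solver using (module +-*-Solver)
import Data.Rational.Unnormalised.Base as ℚᵘ
import Data.Rational.Unnormalised.Properties as ℚᵘ
open import Data.Sum.Base using (inj₁; inj₂)
open import Data.Vec.Base using ([]; _∷_)
open import Function.Bundles using (_⇔_; mk⇔)
open import Level using (0ℓ)
open import Relation.Binary.PropositionalEquality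
  using (_≡_; _≢_; refl; sym; trans; cong; cong₂; subst; subst₂)
open import Relation.Nullary.Decidable using (⌊_⌋; yes; no)
open import Relation.Nullary.Negation using (¬_; contradiction)
open +-*-Solver

private variable
  p q p′ q′ δ ε : ℚ

-- Rational arithmetic

≤⇒≯ : p ℚ.≤ q → ¬ (q ℚ.< p)
≤⇒≯ p≤q q<p = ℚ.<-irrefl refl (ℚ.≤-<-trans p≤q q<p)

-- Adds `p′ - p` to both sides. Stating the link as an equality of differences turns every
-- rearrangement of an inequality into one goal for the ring solver.
shift-< : p ℚ.< q → q ℚ.- p ≡ q′ ℚ.- p′ → p′ ℚ.< q′
shift-< {p} {q} {q′} {p′} p<q eq = subst₂ ℚ._<_ (lhs p p′)
  (trans (rhs p q p′) (trans (cong (ℚ._+ p′) eq) (back q′ p′)))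
  (ℚ.+-monoˡ-< (p′ ℚ.- p) p<q)
  where
  lhs : ∀ p p′ → p ℚ.+ (p′ ℚ.- p) ≡ p′
  lhs = solve 2 (λ p p′ → p :+ (p′ :- p) := p′) refl
  rhs : ∀ p q p′ → q ℚ.+ (p′ ℚ.- p) ≡ (q ℚ.- p) ℚ.+ p′
  rhs = solve 3 (λ p q p′ → q :+ (p′ :- p) := (q :- p) :+ p′) refl
  back : ∀ q p → (q ℚ.- p) ℚ.+ p ≡ q
  back = solve 2 (λ q p → (q :- p) :+ p := q) refl

±p<ε⇒∣p∣<ε : p ℚ.< ε → ℚ.- p ℚ.< ε → ∣ p ∣ ℚ.< ε
±p<ε⇒∣p∣<ε {p} p<ε -p<ε with ℚ.∣p∣≡p∨∣p∣≡-p p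
... | inj₁ eq = subst (ℚ._< _) (sym eq) p<ε
... | inj₂ eq = subst (ℚ._< _) (sym eq) -p<ε

p≤∣p∣ : ∀ p → p ℚ.≤ ∣ p ∣
p≤∣p∣ p with ℚ.≤-total 0ℚ p
... | inj₁ 0≤p = ℚ.≤-reflexive (sym (ℚ.0≤p⇒∣p∣≡p 0≤p))
... | inj₂ p≤0 = ℚ.≤-trans p≤0 (ℚ.0≤∣p∣ p)

∣p-q∣≡∣q-p∣ : ∀ p q → ∣ p ℚ.- q ∣ ≡ ∣ q ℚ.- p ∣
∣p-q∣≡∣q-p∣ p q = trans (sym (ℚ.∣-p∣≡∣p∣ (p ℚ.- q)))
  (cong ∣_∣ (solve 2 (λ p q → :- (p :- q) := q :- p) refl p q))

∣p-q∣<ε⇒p<q+ε : ∀ p q → ∣ p ℚ.- q ∣ ℚ.< ε → p ℚ.< q ℚ.+ ε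
∣p-q∣<ε⇒p<q+ε {ε} p q h = shift-< (ℚ.≤-<-trans (p≤∣p∣ (p ℚ.- q)) h)
  (solve 3 (λ p q e → e :- (p :- q) := q :+ e :- p) refl p q ε)

*-nonneg : 0ℚ ℚ.≤ p → 0ℚ ℚ.≤ q → 0ℚ ℚ.≤ p ℚ.* q
*-nonneg {p} {q} 0≤p 0≤q = ℚ.nonNegative⁻¹ (p ℚ.* q)
  {{ℚ.nonNeg*nonNeg⇒nonNeg p {{ℚ.nonNegative 0≤p}} q {{ℚ.nonNegative 0≤q}}}}

+-nonneg : 0ℚ ℚ.≤ p → 0ℚ ℚ.≤ q → 0ℚ ℚ.≤ p ℚ.+ q
+-nonneg 0≤p 0≤q = ℚ.+-mono-≤ 0≤p 0≤q

*-pos : 0ℚ ℚ.< p → 0ℚ ℚ.< q → 0ℚ ℚ.< p ℚ.* q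
*-pos {p} {q} 0<p 0<q = ℚ.positive⁻¹ (p ℚ.* q)
  {{ℚ.pos*pos⇒pos p {{ℚ.positive 0<p}} q {{ℚ.positive 0<q}}}}

square-nonneg : ∀ p → 0ℚ ℚ.≤ p ℚ.* p
square-nonneg p = subst (0ℚ ℚ.≤_) ∣p∣²≡p² (*-nonneg (ℚ.0≤∣p∣ p) (ℚ.0≤∣p∣ p))
  where
  ∣p∣²≡p² : ∣ p ∣ ℚ.* ∣ p ∣ ≡ p ℚ.* p
  ∣p∣²≡p² with ℚ.∣p∣≡p∨∣p∣≡-p p
  ... | inj₁ eq = cong₂ ℚ._*_ eq eq
  ... | inj₂ eq = trans (cong₂ ℚ._*_ eq eq) (solve 1 (λ p → (:- p) :* (:- p) := p :* p) refl p)

square-mono-≤ : 0ℚ ℚ.≤ p → p ℚ.≤ q → p ℚ.* p ℚ.≤ q ℚ.* q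
square-mono-≤ {p} {q} 0≤p p≤q = ℚ.≤-trans
  (ℚ.*-monoˡ-≤-nonNeg p {{ℚ.nonNegative 0≤p}} p≤q)
  (ℚ.*-monoʳ-≤-nonNeg q {{ℚ.nonNegative (ℚ.≤-trans 0≤p p≤q)}} p≤q)

square-cancel-< : 0ℚ ℚ.≤ q → p ℚ.* p ℚ.< q ℚ.* q → p ℚ.< q
square-cancel-< 0≤q p²<q² =
  ℚ.≰⇒> λ q≤p → ≤⇒≯ (square-mono-≤ 0≤q q≤p) p²<q²

p≤p+q : ∀ p → 0ℚ ℚ.≤ q → p ℚ.≤ p ℚ.+ q
p≤p+q {q} p 0≤q = subst (ℚ._≤ p ℚ.+ q) (ℚ.+-identityʳ p) (ℚ.+-monoʳ-≤ p 0≤q)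

p<p+q : ∀ p → 0ℚ ℚ.< q → p ℚ.< p ℚ.+ q
p<p+q {q} p 0<q = subst (ℚ._< p ℚ.+ q) (ℚ.+-identityʳ p) (ℚ.+-monoʳ-< p 0<q)

halve : 0ℚ ℚ.< ε → ∃[ δ ] (0ℚ ℚ.< δ × δ ℚ.+ δ ≡ ε)
halve {ε} 0<ε = ½ ℚ.* ε , *-pos (ℚ.positive⁻¹ ½) 0<ε ,
  solve 1 (λ e → con ½ :* e :+ con ½ :* e := e) refl ε

divide : 0ℚ ℚ.< p → 0ℚ ℚ.< ε → ∃[ δ ] (0ℚ ℚ.< δ × p ℚ.* δ ≡ ε)
divide {p} {ε} 0<p 0<ε = r ℚ.* ε , *-pos (ℚ.positive⁻¹ r {{ℚ.1/pos⇒pos p {{ℚ.positive 0<p}}}}) 0<ε ,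
  trans (sym (ℚ.*-assoc p r ε))
    (trans (cong (ℚ._* ε) (ℚ.*-inverseʳ p {{ℚ.pos⇒nonZero p {{ℚ.positive 0<p}}}})) (ℚ.*-identityˡ ε))
  where r = (ℚ.1/ p) {{ℚ.pos⇒nonZero p {{ℚ.positive 0<p}}}}

-- Archimedean property and approximate square roots in ℚ

ι : ℕ → ℚ
ι zero    = 0ℚ
ι (suc n) = 1ℚ ℚ.+ ι n

-- The recursive form serves the induction in `search`; the normalised fraction lets `archimedean`
-- compare integers.
ι≡ : ∀ n → ι n ≡ mkℚ (+ n) 0 (ℕ.sym (ℕ.1-coprimeTo n))
ι≡ zero    = ℚ.mkℚ-cong refl refl
ι≡ (suc n) = trans (cong (1ℚ ℚ.+_) (ι≡ n))
  (ℚ.toℚᵘ-injective (ℚᵘ.≃-trans (ℚ.toℚᵘ-homo-+ 1ℚ (mkℚ (+ n) 0 (ℕ.sym (ℕ.1-coprimeTo n))))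
    (ℚᵘ.*≡* (cong (ℤ._* + 1) (cong (λ m → + 1 ℤ.+ m) (ℤ.*-identityʳ (+ n)))))))

archimedean : ∀ p → ∃[ N ] p ℚ.< ι N
archimedean (mkℚ m d c) = suc ℤ.∣ m ∣ ,
  subst (mkℚ m d c ℚ.<_) (sym (ι≡ (suc ℤ.∣ m ∣)))
    (ℚ.*<* (subst (ℤ._< + suc ℤ.∣ m ∣ ℤ.* + suc d) (sym (ℤ.*-identityʳ m)) (bound m)))
  where
  bound : ∀ m → m ℤ.< + suc ℤ.∣ m ∣ ℤ.* + suc d
  bound (+ n)    = ℤ.+<+ (ℕ.≤-trans (ℕ.m≤m*n (suc n) (suc d)) ℕ.≤-refl)
  bound -[1+ n ] = ℤ.-<+

1/suc : ℕ → ℚ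
1/suc n = mkℚ (+ 1) n (ℕ.1-coprimeTo (suc n))

0<1/suc : ∀ n → 0ℚ ℚ.< 1/suc n
0<1/suc n = ℚ.positive⁻¹ (1/suc n)

-- A positive fraction (k+1)/(d+1) is at least 1/(d+1), so N = d suffices.
1/suc-small : 0ℚ ℚ.< ε → ∃[ N ] (∀ n → N ℕ.≤ n → 1/suc n ℚ.≤ ε)
1/suc-small {mkℚ (+ zero)  d c} (ℚ.*<* (ℤ.+<+ ()))
1/suc-small {mkℚ (+ suc k) d c} _ = d , λ n d≤n →
  ℚ.*≤* (ℤ.+≤+ (ℕ.*-mono-≤ {1} {suc k} (ℕ.s≤s ℕ.z≤n) (ℕ.s≤s d≤n)))
1/suc-small {mkℚ -[1+ _ ] d c} (ℚ.*<* ())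

-- Walks upward from `s` in steps of `δ`, keeping s² ≤ q < (s + Nδ)² while N counts down. At N = 0
-- the two bounds contradict each other, so the walk stops earlier.
search : 0ℚ ℚ.≤ δ → ∀ N s → 0ℚ ℚ.≤ s → s ℚ.* s ℚ.≤ q →
  q ℚ.< (s ℚ.+ ι N ℚ.* δ) ℚ.* (s ℚ.+ ι N ℚ.* δ) →
  ∃[ t ] (0ℚ ℚ.≤ t × t ℚ.* t ℚ.≤ q × q ℚ.< (t ℚ.+ δ) ℚ.* (t ℚ.+ δ))
search {δ} {q} 0≤δ zero s 0≤s s²≤q q<
  = contradiction (subst (q ℚ.<_) (solve 2 (λ s d → (s :+ con 0ℚ :* d) :* (s :+ con 0ℚ :* d) := s :* s) refl s δ) q<)
      (≤⇒≯ s²≤q)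
search {δ} {q} 0≤δ (suc N) s 0≤s s²≤q q< with (s ℚ.+ δ) ℚ.* (s ℚ.+ δ) ℚ.≤? q
... | yes ≤q = search 0≤δ N (s ℚ.+ δ) (+-nonneg 0≤s 0≤δ) ≤q
      (subst (λ t → q ℚ.< t ℚ.* t)
        (solve 3 (λ s n d → s :+ (con 1ℚ :+ n) :* d := s :+ d :+ n :* d) refl s (ι N) δ) q<)
... | no ≰q = s , 0≤s , s²≤q , ℚ.≰⇒> ≰q

approximate-root : 0ℚ ℚ.≤ q → 0ℚ ℚ.< δ →
  ∃[ t ] (0ℚ ℚ.≤ t × t ℚ.* t ℚ.≤ q × q ℚ.< (t ℚ.+ δ) ℚ.* (t ℚ.+ δ))
approximate-root {q} {δ} 0≤q 0<δ =
  let 0<q+1 = ℚ.+-mono-≤-< 0≤q (ℚ.positive⁻¹ 1ℚ)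
      t , _ , δt≡q+1 = divide 0<δ 0<q+1
      N , t<N = archimedean t
      q+1<Nδ = subst₂ ℚ._<_ δt≡q+1 (solve 2 (λ n d → d :* n := con 0ℚ :+ n :* d) refl (ι N) δ)
                 (ℚ.*-monoʳ-<-pos δ {{ℚ.positive 0<δ}} t<N)
  in search (ℚ.<⇒≤ 0<δ) N 0ℚ ℚ.≤-refl 0≤q
       -- The initial upper bound is q < (q+1)² ≤ (Nδ)², as (q+1)² - q = q² + q + 1 is positive.
       (ℚ.<-≤-trans
         (shift-< (ℚ.+-mono-≤-< (+-nonneg (square-nonneg q) 0≤q) (ℚ.positive⁻¹ 1ℚ))
           (solve 1 (λ q → q :* q :+ q :+ con 1ℚ :- con 0ℚ := (q :+ con 1ℚ) :* (q :+ con 1ℚ) :- q) refl q))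
         (square-mono-≤ (ℚ.<⇒≤ 0<q+1) (ℚ.<⇒≤ q+1<Nδ)))

-- Order and equality of Cauchy reals

Eventually : (ℕ → Set) → Set
Eventually P = ∃[ N ] (∀ n → N ℕ.≤ n → P n)

private variable
  P Q R : ℕ → Set
  x y z x′ y′ : ℝ

always : (∀ n → P n) → Eventually P
always h = 0 , λ n _ → h n

map-ev : (∀ n → P n → Q n) → Eventually P → Eventually Q
map-ev f (N , p) = N , λ n N≤n → f n (p n N≤n)

zip-ev : (∀ n → P n → Q n → R n) → Eventually P → Eventually Q → Eventually R
zip-ev f (M , p) (N , q) = M ⊔ N , λ n ≤n →
  f n (p n (ℕ.m⊔n≤o⇒m≤o M N ≤n)) (q n (ℕ.m⊔n≤o⇒n≤o M N ≤n))

pointwise : (∀ n → seq x n ≡ seq y n) → x ≈ y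
pointwise {x} {y} h = mk≈ λ ε 0<ε → always λ n →
  subst (λ p → ∣ p ∣ ℚ.< ε)
    (trans (sym (ℚ.+-inverseʳ (seq y n))) (cong (ℚ._- seq y n) (sym (h n)))) 0<ε

pointwise-≤ : (∀ n → seq x n ℚ.≤ seq y n) → x ≤ y
pointwise-≤ {x} {y} h = mk≤ λ ε 0<ε → always λ n →
  ℚ.≤-<-trans (h n) (p<p+q (seq y n) 0<ε)

-- The real counterpart of `shift-<`: the differences agree term by term, so the rational solver
-- also rearranges real inequalities.
≤-shift : x ≤ y → (∀ n → seq y n ℚ.- seq x n ≡ seq y′ n ℚ.- seq x′ n) → x′ ≤ y′
≤-shift {x} {y} {y′} {x′} x≤y h = mk≤ λ ε 0<ε →
  map-ev (λ n lt → shift-< lt (trans (reassoc (seq y n) ε (seq x n))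
    (trans (cong (ℚ._+ ε) (h n)) (sym (reassoc (seq y′ n) ε (seq x′ n))))))
    (bound≤ x≤y ε 0<ε)
  where
  reassoc : ∀ p e q → p ℚ.+ e ℚ.- q ≡ (p ℚ.- q) ℚ.+ e
  reassoc = solve 3 (λ p e q → p :+ e :- q := (p :- q) :+ e) refl

≈⇒≤ : x ≈ y → x ≤ y
≈⇒≤ {x} {y} x≈y = mk≤ λ ε 0<ε →
  map-ev (λ n → ∣p-q∣<ε⇒p<q+ε (seq x n) (seq y n)) (bound≈ x≈y ε 0<ε)

≤-trans : x ≤ y → y ≤ z → x ≤ z
≤-trans {x} {y} {z} x≤y y≤z = mk≤ λ ε 0<ε →
  let δ , 0<δ , δ+δ≡ε = halve 0<ε in
  zip-ev (λ n p q → subst (seq x n ℚ.<_)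
      (trans (ℚ.+-assoc (seq z n) δ δ) (cong (seq z n ℚ.+_) δ+δ≡ε))
      (ℚ.<-trans p (ℚ.+-monoˡ-< δ q)))
    (bound≤ x≤y δ 0<δ) (bound≤ y≤z δ 0<δ)

≤-antisym : x ≤ y → y ≤ x → x ≈ y
≤-antisym {x} {y} x≤y y≤x = mk≈ λ ε 0<ε →
  zip-ev (λ n p q → ±p<ε⇒∣p∣<ε
      (shift-< p (solve 3 (λ x y e → y :+ e :- x := e :- (x :- y)) refl (seq x n) (seq y n) ε))
      (shift-< q (solve 3 (λ x y e → x :+ e :- y := e :- (:- (x :- y))) refl (seq x n) (seq y n) ε)))
    (bound≤ x≤y ε 0<ε) (bound≤ y≤x ε 0<ε)

≈-refl : x ≈ x
≈-refl = pointwise λ _ → refl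

≈-sym : x ≈ y → y ≈ x
≈-sym {x} {y} x≈y = mk≈ λ ε 0<ε →
  map-ev (λ n → subst (ℚ._< ε) (∣p-q∣≡∣q-p∣ (seq x n) (seq y n))) (bound≈ x≈y ε 0<ε)

≈-trans : x ≈ y → y ≈ z → x ≈ z
≈-trans x≈y y≈z = ≤-antisym
  (≤-trans (≈⇒≤ x≈y) (≈⇒≤ y≈z)) (≤-trans (≈⇒≤ (≈-sym y≈z)) (≈⇒≤ (≈-sym x≈y)))

+-mono-≤ : x ≤ y → x′ ≤ y′ → x + x′ ≤ y + y′
+-mono-≤ {x} {y} {x′} {y′} x≤y x′≤y′ = ≤-trans {y = y + x′}
  (≤-shift x≤y λ n → solve 3 (λ x y x′ → y :- x := y :+ x′ :- (x :+ x′)) refl (seq x n) (seq y n) (seq x′ n))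
  (≤-shift x′≤y′ λ n → solve 3 (λ y x′ y′ → y′ :- x′ := y :+ y′ :- (y :+ x′)) refl (seq y n) (seq x′ n) (seq y′ n))

+-cong : x ≈ y → x′ ≈ y′ → x + x′ ≈ y + y′
+-cong x≈y x′≈y′ = ≤-antisym (+-mono-≤ (≈⇒≤ x≈y) (≈⇒≤ x′≈y′))
  (+-mono-≤ (≈⇒≤ (≈-sym x≈y)) (≈⇒≤ (≈-sym x′≈y′)))

neg-cong : x ≈ y → - x ≈ - y
neg-cong {x} {y} x≈y = ≤-antisym (flip≤ x y (≈⇒≤ (≈-sym x≈y))) (flip≤ y x (≈⇒≤ x≈y))
  where
  flip≤ : ∀ x y → y ≤ x → - x ≤ - y
  flip≤ x y y≤x = ≤-shift y≤x λ n → solve 2 (λ x y → x :- y := :- y :- (:- x)) refl (seq x n) (seq y n)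

eventually-bounded : ∀ x → ∃[ B ] (0ℚ ℚ.< B × Eventually (λ n → ∣ seq x n ∣ ℚ.≤ B))
eventually-bounded x =
  let N , h = cauchy x 1ℚ (ℚ.positive⁻¹ 1ℚ)
      xN = seq x N
  in ∣ xN ∣ ℚ.+ 1ℚ , ℚ.+-mono-≤-< (ℚ.0≤∣p∣ xN) (ℚ.positive⁻¹ 1ℚ) , N , λ n N≤n →
    ℚ.≤-trans
      (subst (λ p → ∣ p ∣ ℚ.≤ ∣ xN ∣ ℚ.+ ∣ seq x n ℚ.- xN ∣)
        (solve 2 (λ a b → b :+ (a :- b) := a) refl (seq x n) xN)
        (ℚ.∣p+q∣≤∣p∣+∣q∣ xN (seq x n ℚ.- xN)))
      (ℚ.+-monoʳ-≤ ∣ xN ∣ (ℚ.<⇒≤ (h n N N≤n ℕ.≤-refl)))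

*-congˡ : y ≈ y′ → x * y ≈ x * y′
*-congˡ {y} {y′} {x} y≈y′ = mk≈ λ ε 0<ε →
  let B , 0<B , ∣x∣≤B = eventually-bounded x
      δ , 0<δ , Bδ≡ε = divide 0<B 0<ε
  in zip-ev (λ n ∣xₙ∣≤B ∣d∣<δ →
       let d = seq y n ℚ.- seq y′ n in
       subst₂ ℚ._<_
         (trans (sym (ℚ.∣p*q∣≡∣p∣*∣q∣ (seq x n) d))
           (cong ∣_∣ (solve 3 (λ x y y′ → x :* (y :- y′) := x :* y :- x :* y′) refl (seq x n) (seq y n) (seq y′ n))))
         Bδ≡ε
         (ℚ.≤-<-trans (ℚ.*-monoʳ-≤-nonNeg ∣ d ∣ {{ℚ.nonNegative (ℚ.0≤∣p∣ d)}} ∣xₙ∣≤B)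
           (ℚ.*-monoʳ-<-pos B {{ℚ.positive 0<B}} ∣d∣<δ)))
     ∣x∣≤B (bound≈ y≈y′ δ 0<δ)

*-comm : ∀ x y → x * y ≈ y * x
*-comm x y = pointwise λ n → ℚ.*-comm (seq x n) (seq y n)

*-cong : x ≈ y → x′ ≈ y′ → x * x′ ≈ y * y′
*-cong {x} {y} {x′} {y′} x≈y x′≈y′ = ≈-trans (*-congˡ x′≈y′)
  (≈-trans (*-comm x y′) (≈-trans (*-congˡ x≈y) (*-comm y′ y)))

<-≤-trans : x < y → y ≤ z → x < z
<-≤-trans {x} {y} {z} x<y y≤z =
  let ε , 0<ε , x+ε<y = bound< x<y
      δ , 0<δ , δ+δ≡ε = halve 0<ε
  in mk< (δ , 0<δ , zip-ev (λ n p q → shift-< (ℚ.<-trans p q)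
      (trans (cong (λ e → seq z n ℚ.+ δ ℚ.- (seq x n ℚ.+ e)) (sym δ+δ≡ε))
        (solve 3 (λ x z d → z :+ d :- (x :+ (d :+ d)) := z :- (x :+ d)) refl (seq x n) (seq z n) δ)))
    x+ε<y (bound≤ y≤z δ 0<δ))

<-shift : x < y → (∀ n → seq y n ℚ.- seq x n ≡ seq y′ n ℚ.- seq x′ n) → x′ < y′
<-shift {x} {y} {y′} {x′} x<y h =
  let ε , 0<ε , x+ε<y = bound< x<y
  in mk< (ε , 0<ε , map-ev (λ n lt → shift-< lt
      (trans (reassoc (seq y n) (seq x n) ε) (trans (cong (ℚ._- ε) (h n)) (sym (reassoc (seq y′ n) (seq x′ n) ε)))))
    x+ε<y)
  where
  reassoc : ∀ p q e → p ℚ.- (q ℚ.+ e) ≡ (p ℚ.- q) ℚ.- e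
  reassoc = solve 3 (λ p q e → p :- (q :+ e) := (p :- q) :- e) refl

pos⇒eventually-pos : 0ℝ < x → Eventually (λ n → 0ℚ ℚ.< seq x n)
pos⇒eventually-pos 0<x =
  let ε , 0<ε , h = bound< 0<x
  in map-ev (λ n → ℚ.<-trans (subst (0ℚ ℚ.<_) (sym (ℚ.+-identityˡ ε)) 0<ε)) h

<⇒≤ : x < y → x ≤ y
<⇒≤ {x} {y} x<y = mk≤ λ δ 0<δ →
  let ε , 0<ε , h = bound< x<y
  in map-ev (λ n p → ℚ.<-trans (p<p+q (seq x n) 0<ε) (ℚ.<-trans p (p<p+q (seq y n) 0<δ))) h

x≤x+y : 0ℝ ≤ y → x ≤ x + y
x≤x+y {y} {x} 0≤y = ≤-shift 0≤y λ n →
  solve 2 (λ x y → y :- con 0ℚ := x :+ y :- x) refl (seq x n) (seq y n)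

+-pos : 0ℝ < x → 0ℝ < y → 0ℝ < x + y
+-pos 0<x 0<y = <-≤-trans 0<x (x≤x+y (<⇒≤ 0<y))

*-pos-ℝ : 0ℝ < x → 0ℝ < y → 0ℝ < x * y
*-pos-ℝ {x} {y} 0<x 0<y =
  let ε , 0<ε , ε<x = bound< 0<x
      δ , 0<δ , δ<y = bound< 0<y
  in mk< (ε ℚ.* δ , *-pos 0<ε 0<δ , zip-ev (λ n p q →
      let ε<xₙ = subst (ℚ._< seq x n) (ℚ.+-identityˡ ε) p
          δ<yₙ = subst (ℚ._< seq y n) (ℚ.+-identityˡ δ) q
          0<xₙ = ℚ.<-trans 0<ε ε<xₙ
      in subst (ℚ._< seq x n ℚ.* seq y n) (sym (ℚ.+-identityˡ (ε ℚ.* δ)))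
           (ℚ.<-trans (ℚ.*-monoˡ-<-pos δ {{ℚ.positive 0<δ}} ε<xₙ)
                      (ℚ.*-monoʳ-<-pos (seq x n) {{ℚ.positive 0<xₙ}} δ<yₙ)))
    ε<x δ<y)

-- Eventually the terms of `z` exceed some fixed ε > 0, so the hypothesis at tolerance εδ yields the
-- conclusion at tolerance δ.
*-cancelˡ-≤ : 0ℝ < z → z * x ≤ z * y → x ≤ y
*-cancelˡ-≤ {z} {x} {y} 0<z zx≤zy = mk≤ λ δ 0<δ →
  let ε , 0<ε , ε<z = bound< 0<z
  in zip-ev (λ n p q →
      let ε<zₙ = subst (ℚ._< seq z n) (ℚ.+-identityˡ ε) p
      in ℚ.*-cancelˡ-<-nonNeg (seq z n) {{ℚ.nonNegative (ℚ.<⇒≤ (ℚ.<-trans 0<ε ε<zₙ))}}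
           (ℚ.<-trans q (subst (seq z n ℚ.* seq y n ℚ.+ ε ℚ.* δ ℚ.<_)
             (sym (ℚ.*-distribˡ-+ (seq z n) (seq y n) δ))
             (ℚ.+-monoʳ-< (seq z n ℚ.* seq y n) (ℚ.*-monoˡ-<-pos δ {{ℚ.positive 0<δ}} ε<zₙ)))))
    ε<z (bound≤ zx≤zy (ε ℚ.* δ) (*-pos 0<ε 0<δ))

pos*square-nonneg : 0ℝ < x → ∀ y → 0ℝ ≤ x * (y * y)
pos*square-nonneg {x} 0<x y = mk≤ λ ε 0<ε →
  map-ev (λ n 0<xₙ → ℚ.≤-<-trans (*-nonneg (ℚ.<⇒≤ 0<xₙ) (square-nonneg (seq y n))) (p<p+q (seq x n ℚ.* (seq y n ℚ.* seq y n)) 0<ε))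
    (pos⇒eventually-pos 0<x)

-- Each summand lies between 0 and the sum. Nonnegativity is taken termwise, the form in which sums
-- of squares provide it.
sum-null : (∀ n → 0ℚ ℚ.≤ seq x n) → (∀ n → 0ℚ ℚ.≤ seq y n) → x + y ≈ 0ℝ → x ≈ 0ℝ × y ≈ 0ℝ
sum-null {x} {y} 0≤x 0≤y x+y≈0 =
  ≤-antisym (≤-trans (x≤x+y (pointwise-≤ 0≤y)) (≈⇒≤ x+y≈0)) (pointwise-≤ 0≤x) ,
  ≤-antisym (≤-trans (≤-trans (x≤x+y {x} {y} (pointwise-≤ 0≤x)) (≈⇒≤ (pointwise λ n → ℚ.+-comm (seq y n) (seq x n)))) (≈⇒≤ x+y≈0))
    (pointwise-≤ 0≤y)

square-null : x * x ≈ 0ℝ → x ≈ 0ℝ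
square-null {x} x²≈0 = mk≈ λ ε 0<ε →
  map-ev (λ n h → subst (ℚ._< ε) (cong ∣_∣ (minus0 (seq x n)))
      (square-cancel-< (ℚ.<⇒≤ 0<ε)
        (subst (ℚ._< ε ℚ.* ε)
          (trans (cong ∣_∣ (sym (minus0 (seq x n ℚ.* seq x n)))) (ℚ.∣p*q∣≡∣p∣*∣q∣ (seq x n) (seq x n))) h)))
    (bound≈ x²≈0 (ε ℚ.* ε) (*-pos 0<ε 0<ε))
  where
  minus0 : ∀ p → p ≡ p ℚ.- 0ℚ
  minus0 = solve 1 (λ p → p := p :- con 0ℚ) refl

-- Square roots

-- A one-sided estimate suffices because m and n may be exchanged.
cauchy-from-excess : ∀ {a : ℕ → ℚ} →
  (∀ ε → 0ℚ ℚ.< ε → ∃[ N ] (∀ m n → N ℕ.≤ m → N ℕ.≤ n → a m ℚ.< a n ℚ.+ ε)) → IsCauchy a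
cauchy-from-excess {a} h ε 0<ε =
  let N , f = h ε 0<ε in N , λ m n N≤m N≤n → ±p<ε⇒∣p∣<ε
    (shift-< (f m n N≤m N≤n) (solve 3 (λ p q e → q :+ e :- p := e :- (p :- q)) refl (a m) (a n) ε))
    (shift-< (f n m N≤n N≤m) (solve 3 (λ p q e → p :+ e :- q := e :- (:- (p :- q))) refl (a m) (a n) ε))

∣_∣ℝ : ℝ → ℝ
∣ x ∣ℝ = mkℝ (λ n → ∣ seq x n ∣) (cauchy-from-excess λ ε 0<ε →
  let N , h = cauchy x ε 0<ε in N , λ m n N≤m N≤n →
  let xm = seq x m ; xn = seq x n in
  ℚ.≤-<-trans
    (subst (λ p → ∣ p ∣ ℚ.≤ ∣ xn ∣ ℚ.+ ∣ xm ℚ.- xn ∣)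
      (solve 2 (λ a b → b :+ (a :- b) := a) refl xm xn) (ℚ.∣p+q∣≤∣p∣+∣q∣ xn (xm ℚ.- xn)))
    (ℚ.+-monoʳ-< ∣ xn ∣ (h m n N≤m N≤n)))

-- A nonnegative real may have negative terms, but eventually only above -δ, where passing to the
-- absolute value costs less than 2δ. This supplies a representative with nonnegative terms.
0≤x⇒x≈∣x∣ : 0ℝ ≤ x → x ≈ ∣ x ∣ℝ
0≤x⇒x≈∣x∣ {x} 0≤x = ≤-antisym (pointwise-≤ λ n → p≤∣p∣ (seq x n)) (mk≤ λ ε 0<ε →
  let δ , 0<δ , δ+δ≡ε = halve 0<ε in
  map-ev (λ n h → bound δ 0<δ δ+δ≡ε (seq x n) h) (bound≤ 0≤x δ 0<δ))
  where
  bound : ∀ δ {ε} → 0ℚ ℚ.< δ → δ ℚ.+ δ ≡ ε → ∀ p → 0ℚ ℚ.< p ℚ.+ δ → ∣ p ∣ ℚ.< p ℚ.+ ε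
  bound δ 0<δ refl p h with ℚ.∣p∣≡p∨∣p∣≡-p p
  ... | inj₁ eq = subst (ℚ._< p ℚ.+ (δ ℚ.+ δ)) (sym eq) (p<p+q p (ℚ.+-mono-< 0<δ 0<δ))
  ... | inj₂ eq = subst (ℚ._< p ℚ.+ (δ ℚ.+ δ)) (sym eq) (shift-< (ℚ.+-mono-< h h)
    (solve 2 (λ p d → (p :+ d) :+ (p :+ d) :- con 0ℚ := p :+ (d :+ d) :- (:- p)) refl p δ))

*-nonneg-ℝ : 0ℝ ≤ x → 0ℝ ≤ y → 0ℝ ≤ x * y
*-nonneg-ℝ {x} {y} 0≤x 0≤y = ≤-trans {y = ∣ x ∣ℝ * ∣ y ∣ℝ}
  (pointwise-≤ λ n → *-nonneg (ℚ.0≤∣p∣ (seq x n)) (ℚ.0≤∣p∣ (seq y n)))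
  (≈⇒≤ (≈-sym (*-cong (0≤x⇒x≈∣x∣ 0≤x) (0≤x⇒x≈∣x∣ 0≤y))))

1/sucℝ : ℝ
1/sucℝ = mkℝ 1/suc λ ε 0<ε →
  let N , h = 1/suc-small 0<ε in N , λ m n N≤m N≤n → ±p<ε⇒∣p∣<ε
    (shift-< (ℚ.+-mono-≤-< (h m N≤m) (0<1/suc n))
      (solve 3 (λ p q e → e :+ q :- (p :+ con 0ℚ) := e :- (p :- q)) refl (1/suc m) (1/suc n) ε))
    (shift-< (ℚ.+-mono-≤-< (h n N≤n) (0<1/suc m))
      (solve 3 (λ p q e → e :+ p :- (q :+ con 0ℚ) := e :- (:- (p :- q))) refl (1/suc m) (1/suc n) ε))

1/sucℝ≈0 : 1/sucℝ ≈ 0ℝ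
1/sucℝ≈0 = ≤-antisym
  (mk≤ λ ε 0<ε → let δ , 0<δ , δ+δ≡ε = halve 0<ε in
    map-ev (λ n h → ℚ.≤-<-trans h (subst₂ ℚ._<_ refl (trans δ+δ≡ε (sym (ℚ.+-identityˡ ε))) (p<p+q δ 0<δ)))
      (1/suc-small 0<δ))
  (pointwise-≤ λ n → ℚ.<⇒≤ (0<1/suc n))

-- The square root of ∣ y ∣, its n-th term being the root of ∣ yₙ ∣ rounded down with
-- error below 1/(n+1).
module Sqrt (y : ℝ) where

  root : ∀ n → ∃[ t ] (0ℚ ℚ.≤ t × t ℚ.* t ℚ.≤ ∣ seq y n ∣ ×
    ∣ seq y n ∣ ℚ.< (t ℚ.+ 1/suc n) ℚ.* (t ℚ.+ 1/suc n))
  root n = approximate-root (ℚ.0≤∣p∣ (seq y n)) (0<1/suc n)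

  s : ℕ → ℚ
  s n = proj₁ (root n)

  -- Uniform continuity of the rounded root: if the radicands differ by less than h² and rounding by
  -- at most h, then u² < (t+h)² + h² ≤ (t+2h)².
  excess : ∀ {p q t u d h} → 0ℚ ℚ.≤ t → 0ℚ ℚ.< d → 0ℚ ℚ.< h → u ℚ.* u ℚ.≤ p → q ℚ.< (t ℚ.+ d) ℚ.* (t ℚ.+ d) →
    d ℚ.≤ h → p ℚ.< q ℚ.+ h ℚ.* h → u ℚ.< t ℚ.+ (h ℚ.+ h)
  excess {p} {q} {t} {u} {d} {h} 0≤t 0<d 0<h u²≤p q<[t+d]² d≤h p<q+h² = square-cancel-<
    (+-nonneg 0≤t (ℚ.<⇒≤ (ℚ.+-mono-< 0<h 0<h)))
    (begin-strict
      u ℚ.* u                                        ≤⟨ u²≤p ⟩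
      p                                              <⟨ p<q+h² ⟩
      q ℚ.+ h ℚ.* h                                  <⟨ ℚ.+-monoˡ-< (h ℚ.* h) q<[t+d]² ⟩
      (t ℚ.+ d) ℚ.* (t ℚ.+ d) ℚ.+ h ℚ.* h            ≤⟨ ℚ.+-monoˡ-≤ (h ℚ.* h)
          (square-mono-≤ (+-nonneg 0≤t (ℚ.<⇒≤ 0<d)) (ℚ.+-monoʳ-≤ t d≤h)) ⟩
      (t ℚ.+ h) ℚ.* (t ℚ.+ h) ℚ.+ h ℚ.* h            ≤⟨ p≤p+q _ 0≤2[t+h]h ⟩
      ((t ℚ.+ h) ℚ.* (t ℚ.+ h) ℚ.+ h ℚ.* h) ℚ.+ ((t ℚ.+ h) ℚ.* h ℚ.+ (t ℚ.+ h) ℚ.* h)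
        ≡⟨ solve 2 (λ t h → ((t :+ h) :* (t :+ h) :+ h :* h) :+ ((t :+ h) :* h :+ (t :+ h) :* h)
             := (t :+ (h :+ h)) :* (t :+ (h :+ h))) refl t h ⟩
      (t ℚ.+ (h ℚ.+ h)) ℚ.* (t ℚ.+ (h ℚ.+ h))        ∎)
    where
    open ℚ.≤-Reasoning
    0≤h = ℚ.<⇒≤ 0<h
    0≤[t+h]h = *-nonneg (+-nonneg 0≤t 0≤h) 0≤h
    0≤2[t+h]h = +-nonneg 0≤[t+h]h 0≤[t+h]h

  s-cauchy : IsCauchy s
  s-cauchy = cauchy-from-excess λ ε 0<ε →
    let h , 0<h , h+h≡ε = halve 0<ε
        M , f = cauchy ∣ y ∣ℝ (h ℚ.* h) (*-pos 0<h 0<h)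
        N , g = 1/suc-small 0<h
    in M ⊔ N , λ m n ≤m ≤n →
      let _ , _ , s²≤p , _ = root m
          _ , 0≤t , _ , q< = root n
      in subst (λ e → s m ℚ.< s n ℚ.+ e) h+h≡ε
        (excess 0≤t (0<1/suc n) 0<h s²≤p q< (g n (ℕ.m⊔n≤o⇒n≤o M N ≤n))
          (∣p-q∣<ε⇒p<q+ε ∣ seq y m ∣ ∣ seq y n ∣ (f m n (ℕ.m⊔n≤o⇒m≤o M N ≤m) (ℕ.m⊔n≤o⇒m≤o M N ≤n))))

  √ : ℝ
  √ = mkℝ s s-cauchy

  0≤√ : 0ℝ ≤ √
  0≤√ = pointwise-≤ λ n → proj₁ (proj₂ (root n))

  √*√≈∣y∣ : √ * √ ≈ ∣ y ∣ℝ
  √*√≈∣y∣ = ≤-antisym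
    (pointwise-≤ λ n → proj₁ (proj₂ (proj₂ (root n))))
    -- The rounding errors form a real number equal to 0, so the termwise upper bound becomes √².
    (≤-trans {y = (√ + 1/sucℝ) * (√ + 1/sucℝ)}
      (pointwise-≤ λ n → ℚ.<⇒≤ (proj₂ (proj₂ (proj₂ (root n)))))
      (≈⇒≤ (*-cong √+0≈√ √+0≈√)))
    where
    √+0≈√ : √ + 1/sucℝ ≈ √
    √+0≈√ = ≈-trans (+-cong ≈-refl 1/sucℝ≈0) (pointwise λ n → ℚ.+-identityʳ (s n))

sqrt : 0ℝ ≤ y → ∃[ r ] (0ℝ ≤ r × r * r ≈ y)
sqrt {y} 0≤y = √ , 0≤√ , ≈-trans √*√≈∣y∣ (≈-sym (0≤x⇒x≈∣x∣ 0≤y))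
  where open Sqrt y

-- Determinants and Laplacians

∑-cong : ∀ {n} {f g : Fin n → ℝ} → (∀ i → f i ≈ g i) → ∑ f ≈ ∑ g
∑-cong {zero}  h = ≈-refl
∑-cong {suc n} h = +-cong (h zero) (∑-cong λ i → h (suc i))

det-cong : ∀ {n} {A B : Matrix n} → (∀ i j → A i j ≈ B i j) → det A ≈ det B
det-cong {zero}  h = ≈-refl
det-cong {suc n} h = ∑-cong λ j →
  *-congˡ {x = (- 1ℝ) ^ toℕ j} (*-cong (h zero j) (det-cong λ i k → h (suc i) (punchIn j k)))

charPoly-cong : ∀ {n} {A B : Matrix n} → (∀ i j → A i j ≈ B i j) → charPoly A x ≈ charPoly B x
charPoly-cong h = det-cong λ i j → +-cong ≈-refl (neg-cong (h i j))

-- Everything the rational solver has to see is written over a raw ring, so that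
-- the same expression can be read in ℝ and among the solver's polynomials.  An
-- identity of real expressions holds termwise, hence is an identity in ℚ.
module Expressions (R : RawRing 0ℓ 0ℓ) where
  open RawRing R using (Carrier; 0#; 1#; +-rawMonoid; rawSemiring)
    renaming (_+_ to infixl 6 _⊕_; _*_ to infixl 7 _⊗_; -_ to infix 8 ⊖_)
  open RawMonoidDefs +-rawMonoid using (sum)
  open RawSemiringDefs rawSemiring using () renaming (_^_ to _^′_)

  infixl 6 _⊝_
  _⊝_ : Carrier → Carrier → Carrier
  x ⊝ y = x ⊕ ⊖ y

  determinant : ∀ {n} → (Fin n → Fin n → Carrier) → Carrier
  determinant {zero}  A = 1#
  determinant {suc n} A = sum λ j →
    (⊖ 1#) ^′ toℕ j ⊗ (A zero j ⊗ determinant (λ i k → A (suc i) (punchIn j k)))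

  characteristic : ∀ {n} → (Fin n → Fin n → Carrier) → Carrier → Carrier
  characteristic A x = determinant λ i j → (if ⌊ i Fin.≟ j ⌋ then x else 0#) ⊝ A i j

  -- The diagonal of `M` is overwritten to make the row sums vanish; the diagonal zeros of `cycle`
  -- are placeholders.
  laplacian : ∀ {n} → (Fin n → Fin n → Carrier) → Fin n → Fin n → Carrier
  laplacian M i j = if ⌊ i Fin.≟ j ⌋
    then ⊖ sum (λ k → if ⌊ k Fin.≟ i ⌋ then 0# else M i k)
    else M i j

  cycle : (a b c d : Carrier) → Fin 4 → Fin 4 → Carrier
  cycle a b c d 0F 1F = ⊖ a
  cycle a b c d 1F 0F = ⊖ a
  cycle a b c d 1F 2F = ⊖ b
  cycle a b c d 2F 1F = ⊖ b
  cycle a b c d 2F 3F = ⊖ c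
  cycle a b c d 3F 2F = ⊖ c
  cycle a b c d 3F 0F = ⊖ d
  cycle a b c d 0F 3F = ⊖ d
  cycle a b c d _  _  = 0#

  -- The characteristic polynomial of the tridiagonal matrix M, and its derivative.
  cubic : (P Q u v x : Carrier) → Carrier
  cubic P Q u v x =
    (x ⊝ Q) ⊗ ((x ⊝ (P ⊕ Q)) ⊗ (x ⊝ P)) ⊝ u ⊗ u ⊗ (x ⊝ P) ⊝ v ⊗ v ⊗ (x ⊝ Q)

  cubic′ : (P Q u v x : Carrier) → Carrier
  cubic′ P Q u v x = (x ⊝ Q) ⊗ (x ⊝ (P ⊕ Q)) ⊕ (x ⊝ (P ⊕ Q)) ⊗ (x ⊝ P) ⊕ (x ⊝ Q) ⊗ (x ⊝ P)
    ⊝ u ⊗ u ⊝ v ⊗ v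

  -- Shaped exactly as the product in `IsSpectrum` unfolds, including `⊝ 0#` and the final `1#`.
  target : (ev μ x : Carrier) → Carrier
  target ev μ x = (x ⊝ 0#) ⊗ ((x ⊝ ev) ⊗ ((x ⊝ ev) ⊗ ((x ⊝ μ) ⊗ 1#)))

  defect : (P Q u v ev μ x : Carrier) → Carrier
  defect P Q u v ev μ x = x ⊗ cubic P Q u v x ⊝ target ev μ x

open Expressions ℝ-rawRing using (laplacian; cycle; cubic; cubic′; defect)

polynomials : ℕ → RawRing 0ℓ 0ℓ
polynomials n = record
  { Carrier = Polynomial n ; _≈_ = _≡_ ; _+_ = _:+_ ; _*_ = _:*_ ; -_ = :-_
  ; 0# = con 0ℚ ; 1# = con 1ℚ }

module Poly {n} = Expressions (polynomials n)

-- The factor `x` comes from the all-ones vector, the cubic from its orthogonal complement. The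
-- solver expands the determinant itself.
charPoly-cycle : ∀ a b c d x →
  charPoly (laplacian (cycle a b c d)) x ≈ x * cubic (a + c) (b + d) (d - b) (a - c) x
charPoly-cycle a b c d x = pointwise λ n → solve 5 (λ a b c d x →
    Poly.characteristic (Poly.laplacian (Poly.cycle a b c d)) x
      := x :* Poly.cubic (a :+ c) (b :+ d) (d :- b) (a :- c) x)
  refl (seq a n) (seq b n) (seq c n) (seq d n) (seq x n)

-- The off-diagonal entries of a matrix in `S_L` determine its diagonal.
S_L⇒laplacian : ∀ {n} {G : SimpleGraph n} {A M : Matrix n} → S_L G A →
  (∀ i j → i ≢ j → A i j ≈ M i j) → ∀ i j → A i j ≈ laplacian M i j
S_L⇒laplacian {A = A} {M} A∈S_L off i j with i Fin.≟ j
... | no i≢j   = off i j i≢j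
... | yes refl = ≈-trans (S_L.diagonal A∈S_L i) (neg-cong (∑-cong row))
  where
  row : ∀ k → (if ⌊ k Fin.≟ i ⌋ then 0ℝ else A i k) ≈ (if ⌊ k Fin.≟ i ⌋ then 0ℝ else M i k)
  row k with k Fin.≟ i
  ... | yes _  = ≈-refl
  ... | no k≢i = off i k λ i≡k → k≢i (sym i≡k)

-- Weighted Laplacians of the 4-cycle

∀-Fin4 : {P : Fin 4 → Set} → P 0F → P 1F → P 2F → P 3F → ∀ i → P i
∀-Fin4 p₀ p₁ p₂ p₃ 0F = p₀
∀-Fin4 p₀ p₁ p₂ p₃ 1F = p₁
∀-Fin4 p₀ p₁ p₂ p₃ 2F = p₂
∀-Fin4 p₀ p₁ p₂ p₃ 3F = p₃

double-neg : x ≈ - - x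
double-neg {x} = pointwise λ n → solve 1 (λ x → x := :- (:- x)) refl (seq x n)

neg-pos : x < 0ℝ → 0ℝ < - x
neg-pos {x} x<0 = <-shift x<0 λ n → solve 1 (λ x → con 0ℚ :- x := :- x :- con 0ℚ) refl (seq x n)

pos-neg : 0ℝ < x → - x < 0ℝ
pos-neg {x} 0<x = <-shift 0<x λ n → solve 1 (λ x → x :- con 0ℚ := con 0ℚ :- (:- x)) refl (seq x n)

S_L-C₄⇒cycle : ∀ {A} → S_L C₄ A → ∀ i j → i ≢ j →
  A i j ≈ cycle (- A 0F 1F) (- A 1F 2F) (- A 2F 3F) (- A 3F 0F) i j
S_L-C₄⇒cycle {A} A∈S_L = ∀-Fin4
  (∀-Fin4 diag (λ _ → double-neg) (none (λ ()) λ { (inj₁ ()) ; (inj₂ ()) }) λ _ → flipped)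
  (∀-Fin4 (λ _ → flipped) diag (λ _ → double-neg) (none (λ ()) λ { (inj₁ ()) ; (inj₂ ()) }))
  (∀-Fin4 (none (λ ()) λ { (inj₁ ()) ; (inj₂ ()) }) (λ _ → flipped) diag λ _ → double-neg)
  (∀-Fin4 (λ _ → double-neg) (none (λ ()) λ { (inj₁ ()) ; (inj₂ ()) }) (λ _ → flipped) diag)
  where
  diag : ∀ {i} {X : Set} → i ≢ i → X
  diag {i} i≢i = contradiction (refl {x = i}) i≢i
  flipped : ∀ {i j} → A i j ≈ - - A j i
  flipped {i} {j} = ≈-trans (S_L.symmetric A∈S_L i j) double-neg
  none : ∀ {i j} → ¬ (i ≡ j) → ¬ Adj C₄ i j → i ≢ j → A i j ≈ 0ℝ
  none {i} {j} i≢j ¬adj _ = S_L.nonEdge A∈S_L i j i≢j ¬adj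

cycle∈S_L : ∀ {a b c d} → 0ℝ < a → 0ℝ < b → 0ℝ < c → 0ℝ < d →
  S_L C₄ (laplacian (cycle a b c d))
cycle∈S_L {a} {b} {c} {d} 0<a 0<b 0<c 0<d = record
  { symmetric = ∀-Fin4
      (∀-Fin4 ≈-refl ≈-refl ≈-refl ≈-refl) (∀-Fin4 ≈-refl ≈-refl ≈-refl ≈-refl)
      (∀-Fin4 ≈-refl ≈-refl ≈-refl ≈-refl) (∀-Fin4 ≈-refl ≈-refl ≈-refl ≈-refl)
  ; edge = ∀-Fin4
      (∀-Fin4 (λ { (inj₁ ()) ; (inj₂ ()) }) (λ _ → pos-neg 0<a) (λ { (inj₁ ()) ; (inj₂ ()) }) (λ _ → pos-neg 0<d))
      (∀-Fin4 (λ _ → pos-neg 0<a) (λ { (inj₁ ()) ; (inj₂ ()) }) (λ _ → pos-neg 0<b) (λ { (inj₁ ()) ; (inj₂ ()) }))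
      (∀-Fin4 (λ { (inj₁ ()) ; (inj₂ ()) }) (λ _ → pos-neg 0<b) (λ { (inj₁ ()) ; (inj₂ ()) }) (λ _ → pos-neg 0<c))
      (∀-Fin4 (λ _ → pos-neg 0<d) (λ { (inj₁ ()) ; (inj₂ ()) }) (λ _ → pos-neg 0<c) (λ { (inj₁ ()) ; (inj₂ ()) }))
  ; nonEdge = ∀-Fin4
      (∀-Fin4 (λ i≢i _ → contradiction refl i≢i) (λ _ e → contradiction (inj₁ refl) e) (λ _ _ → ≈-refl) (λ _ e → contradiction (inj₂ refl) e))
      (∀-Fin4 (λ _ e → contradiction (inj₂ refl) e) (λ i≢i _ → contradiction refl i≢i) (λ _ e → contradiction (inj₁ refl) e) (λ _ _ → ≈-refl))
      (∀-Fin4 (λ _ _ → ≈-refl) (λ _ e → contradiction (inj₂ refl) e) (λ i≢i _ → contradiction refl i≢i) (λ _ e → contradiction (inj₁ refl) e))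
      (∀-Fin4 (λ _ e → contradiction (inj₁ refl) e) (λ _ _ → ≈-refl) (λ _ e → contradiction (inj₂ refl) e) (λ i≢i _ → contradiction refl i≢i))
  ; diagonal = ∀-Fin4 ≈-refl ≈-refl ≈-refl ≈-refl
  }

-- A double eigenvalue

module DoubleRoot (ev μ P Q u v : ℝ) (0<P : 0ℝ < P) (0<Q : 0ℝ < Q)
  (defect≈0 : ∀ x → defect P Q u v ev μ x ≈ 0ℝ) where

  ½ℝ ⅙ℝ 3ℝ : ℝ
  ½ℝ = fromℚ ½
  ⅙ℝ = fromℚ (+ 1 ℚ./ 6)
  3ℝ = fromℚ (1ℚ ℚ.+ (1ℚ ℚ.+ 1ℚ))

  -- cubic - (x - ev)²(x - μ) is quadratic, so its values at 1, 2, 3 determine it.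
  combination≈0 : ∀ a b c →
    a * defect P Q u v ev μ 1ℝ + (b * defect P Q u v ev μ 2ℝ + c * defect P Q u v ev μ 3ℝ) ≈ 0ℝ
  combination≈0 a b c = ≈-trans
    (+-cong (*-congˡ {x = a} (defect≈0 1ℝ)) (+-cong (*-congˡ {x = b} (defect≈0 2ℝ)) (*-congˡ {x = c} (defect≈0 3ℝ))))
    (pointwise λ n → solve 3 (λ a b c → a :* con 0ℚ :+ (b :* con 0ℚ :+ c :* con 0ℚ) := con 0ℚ) refl
      (seq a n) (seq b n) (seq c n))

  -- At the node k the defect is k times the quadratic. Dividing the Lagrange weights by k = 1, 2, 3
  -- gives the constants ½, -½, ⅙ used with it.
  lagrange : ∀ {e} a b c →
    (∀ n → seq e n ≡ seq (a * defect P Q u v ev μ 1ℝ + (b * defect P Q u v ev μ 2ℝ + c * defect P Q u v ev μ 3ℝ)) n) →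
    e ≈ 0ℝ
  lagrange a b c h = ≈-trans (pointwise h) (combination≈0 a b c)

  -- This is the leading coefficient of the interpolated quadratic.
  trace≈ : (ev + ev + μ) - 2ℝ * (P + Q) ≈ 0ℝ
  trace≈ = lagrange ½ℝ (- ½ℝ) ⅙ℝ λ n →
    solve 6 (λ l m P Q u v →
      (l :+ l :+ m) :- con (1ℚ ℚ.+ 1ℚ) :* (P :+ Q) :=
        con ½ :* Poly.defect P Q u v l m (con 1ℚ)
        :+ ((:- con ½) :* Poly.defect P Q u v l m (con (1ℚ ℚ.+ 1ℚ))
        :+ con (+ 1 ℚ./ 6) :* Poly.defect P Q u v l m (con (1ℚ ℚ.+ (1ℚ ℚ.+ 1ℚ)))))
      refl (seq ev n) (seq μ n) (seq P n) (seq Q n) (seq u n) (seq v n)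

  cubic≈0 : cubic P Q u v ev ≈ 0ℝ
  cubic≈0 = lagrange (½ℝ * ((ev - 2ℝ) * (ev - 3ℝ))) (- ½ℝ * ((ev - 1ℝ) * (ev - 3ℝ)))
      (⅙ℝ * ((ev - 1ℝ) * (ev - 2ℝ))) λ n →
    solve 6 (λ l m P Q u v →
      let 2# = con (1ℚ ℚ.+ 1ℚ) ; 3# = con (1ℚ ℚ.+ (1ℚ ℚ.+ 1ℚ)) in
      Poly.cubic P Q u v l :=
        (con ½ :* ((l :- 2#) :* (l :- 3#))) :* Poly.defect P Q u v l m (con 1ℚ)
        :+ (((:- con ½) :* ((l :- con 1ℚ) :* (l :- 3#))) :* Poly.defect P Q u v l m 2#
        :+ (con (+ 1 ℚ./ 6) :* ((l :- con 1ℚ) :* (l :- 2#))) :* Poly.defect P Q u v l m 3#))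
      refl (seq ev n) (seq μ n) (seq P n) (seq Q n) (seq u n) (seq v n)

  -- The weights are the derivatives at `ev` of the Lagrange basis polynomials; (x - ev)²(x - μ) has
  -- zero derivative there.
  cubic′≈0 : cubic′ P Q u v ev ≈ 0ℝ
  cubic′≈0 = lagrange (½ℝ * (ev + ev - 2ℝ - 3ℝ)) (- ½ℝ * (ev + ev - 1ℝ - 3ℝ))
      (⅙ℝ * (ev + ev - 1ℝ - 2ℝ)) λ n →
    solve 6 (λ l m P Q u v →
      let 2# = con (1ℚ ℚ.+ 1ℚ) ; 3# = con (1ℚ ℚ.+ (1ℚ ℚ.+ 1ℚ)) in
      Poly.cubic′ P Q u v l :=
        (con ½ :* (l :+ l :- 2# :- 3#)) :* Poly.defect P Q u v l m (con 1ℚ)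
        :+ (((:- con ½) :* (l :+ l :- con 1ℚ :- 3#)) :* Poly.defect P Q u v l m 2#
        :+ (con (+ 1 ℚ./ 6) :* (l :+ l :- con 1ℚ :- 2#)) :* Poly.defect P Q u v l m 3#))
      refl (seq ev n) (seq μ n) (seq P n) (seq Q n) (seq u n) (seq v n)

  -- g₁, g₂, g₃ are the diagonal entries of the adjugate of ev·I - M, and rest is
  -- the sum of the squares of its off-diagonal entries uv, uY, vX.
  X Y Z g₁ g₂ g₃ rest : ℝ
  X = ev - Q
  Y = ev - P
  Z = ev - (P + Q)
  g₁ = Z * Y - v * v
  g₂ = X * Y
  g₃ = X * Z - u * u
  rest = (u * v) * (u * v) + (u * v) * (u * v)
       + ((u * Y) * (u * Y) + (u * Y) * (u * Y))
       + ((v * X) * (v * X) + (v * X) * (v * X))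

  square-nonneg² : ∀ x n → 0ℚ ℚ.≤ seq (x * x + x * x) n
  square-nonneg² x n = +-nonneg (square-nonneg (seq x n)) (square-nonneg (seq x n))

  rest-nonneg : ∀ n → 0ℚ ℚ.≤ seq rest n
  rest-nonneg n = +-nonneg (+-nonneg (square-nonneg² (u * v) n) (square-nonneg² (u * Y) n)) (square-nonneg² (v * X) n)

  -- The left side is tr N² = (tr N)² - 2 e₂(N), where tr N is `cubic′` at `ev` and e₂(N) is
  -- `X + Y + Z` times `cubic` at `ev`.
  adjugate-norm≈0 : g₁ * g₁ + (g₂ * g₂ + (g₃ * g₃ + rest)) ≈ 0ℝ
  adjugate-norm≈0 = ≈-trans {y = cubic′ P Q u v ev * cubic′ P Q u v ev - 2ℝ * (X + Y + Z) * cubic P Q u v ev}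
    (pointwise λ n → solve 5 (λ l P Q u v →
      let X = l :- Q ; Y = l :- P ; Z = l :- (P :+ Q)
          g₁ = Z :* Y :- v :* v ; g₂ = X :* Y ; g₃ = X :* Z :- u :* u in
      g₁ :* g₁ :+ (g₂ :* g₂ :+ (g₃ :* g₃ :+
        ((u :* v) :* (u :* v) :+ (u :* v) :* (u :* v)
       :+ ((u :* Y) :* (u :* Y) :+ (u :* Y) :* (u :* Y))
       :+ ((v :* X) :* (v :* X) :+ (v :* X) :* (v :* X))))) :=
      Poly.cubic′ P Q u v l :* Poly.cubic′ P Q u v l
        :- con (1ℚ ℚ.+ 1ℚ) :* (X :+ Y :+ Z) :* Poly.cubic P Q u v l)
      refl (seq ev n) (seq P n) (seq Q n) (seq u n) (seq v n))
    (≈-trans {y = 0ℝ * 0ℝ - 2ℝ * (X + Y + Z) * 0ℝ}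
      (+-cong (*-cong cubic′≈0 cubic′≈0) (neg-cong (*-congˡ {x = 2ℝ * (X + Y + Z)} cubic≈0)))
      (pointwise λ n → solve 1 (λ s → con 0ℚ :* con 0ℚ :- s :* con 0ℚ := con 0ℚ) refl (seq (2ℝ * (X + Y + Z)) n)))

  minors≈0 : g₁ ≈ 0ℝ × g₂ ≈ 0ℝ × g₃ ≈ 0ℝ
  minors≈0 =
    let 0≤² : ∀ x n → 0ℚ ℚ.≤ seq (x * x) n
        0≤² x n = square-nonneg (seq x n)
        g₃-nonneg = λ n → +-nonneg (0≤² g₃ n) (rest-nonneg n)
        h₁ , t = sum-null {g₁ * g₁} {g₂ * g₂ + (g₃ * g₃ + rest)} (0≤² g₁)
                   (λ n → +-nonneg (0≤² g₂ n) (g₃-nonneg n)) adjugate-norm≈0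
        h₂ , t′ = sum-null {g₂ * g₂} {g₃ * g₃ + rest} (0≤² g₂) g₃-nonneg t
        h₃ , _ = sum-null {g₃ * g₃} {rest} (0≤² g₃) rest-nonneg t′
    in square-null {g₁} h₁ , square-null {g₂} h₂ , square-null {g₃} h₃

  W : ℝ
  W = Q * (v * v) + P * (u * u)

  -- The combination Q g₁ + P g₃ - (P+Q) g₂ equals PQ(P+Q - 2ev) - W, and the three minors vanish.
  -- Doubling it and adding PQ times `trace≈` trades P+Q for μ.
  PQμ≈ : P * Q * μ ≈ P * Q * (2ℝ * ev) + (W + W)
  PQμ≈ = ≈-trans {y = P * Q * (2ℝ * ev) + (W + W) + (E g₁ g₂ g₃ (ev + ev + μ - 2ℝ * (P + Q)))}
    (pointwise λ n → solve 6 (λ l m P Q u v →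
      let X = l :- Q ; Y = l :- P ; Z = l :- (P :+ Q)
          g₁ = Z :* Y :- v :* v ; g₂ = X :* Y ; g₃ = X :* Z :- u :* u
          2# = con (1ℚ ℚ.+ 1ℚ) ; W = Q :* (v :* v) :+ P :* (u :* u) in
      P :* Q :* m := P :* Q :* (2# :* l) :+ (W :+ W)
        :+ (2# :* Q :* g₁ :+ 2# :* P :* g₃ :- 2# :* (P :+ Q) :* g₂ :+ P :* Q :* (l :+ l :+ m :- 2# :* (P :+ Q))))
      refl (seq ev n) (seq μ n) (seq P n) (seq Q n) (seq u n) (seq v n))
    (≈-trans {y = P * Q * (2ℝ * ev) + (W + W) + E 0ℝ 0ℝ 0ℝ 0ℝ}
      (+-cong (≈-refl {P * Q * (2ℝ * ev) + (W + W)})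
        (let h₁ , h₂ , h₃ = minors≈0 in
         +-cong (+-cong (+-cong (*-congˡ {x = 2ℝ * Q} h₁) (*-congˡ {x = 2ℝ * P} h₃))
                        (neg-cong (*-congˡ {x = 2ℝ * (P + Q)} h₂)))
                (*-congˡ {x = P * Q} trace≈)))
      (pointwise λ n → solve 5 (λ a b c d e → a :+ (b :* con 0ℚ :+ c :* con 0ℚ :- d :* con 0ℚ :+ e :* con 0ℚ) := a) refl
        (seq (P * Q * (2ℝ * ev) + (W + W)) n) (seq (2ℝ * Q) n) (seq (2ℝ * P) n) (seq (2ℝ * (P + Q)) n) (seq (P * Q) n)))
    where
    E : ℝ → ℝ → ℝ → ℝ → ℝ
    E a b c d = 2ℝ * Q * a + 2ℝ * P * c - 2ℝ * (P + Q) * b + P * Q * d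

  0≤W : 0ℝ ≤ W
  0≤W = ≤-trans (pos*square-nonneg 0<Q v) (x≤x+y {P * (u * u)} {Q * (v * v)} (pos*square-nonneg 0<P u))

  2ev≤μ : 2ℝ * ev ≤ μ
  2ev≤μ = *-cancelˡ-≤ (*-pos-ℝ 0<P 0<Q)
    (≤-trans (x≤x+y {W + W} {P * Q * (2ℝ * ev)} (≤-trans 0≤W (x≤x+y {W} {W} 0≤W))) (≈⇒≤ (≈-sym PQμ≈)))

-- The two implications

realizable⇒≥ : ∀ ev μ → LaplacianRealizable C₄ (0ℝ ∷ ev ∷ ev ∷ μ ∷ []) → 2ℝ * ev ≤ μ
realizable⇒≥ ev μ (A , A∈S_L , spectrum) = DoubleRoot.2ev≤μ ev μ (a + c) (b + d) (d - b) (a - c)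
  (+-pos (weight 0F 1F (inj₁ refl)) (weight 2F 3F (inj₁ refl)))
  (+-pos (weight 1F 2F (inj₁ refl)) (weight 3F 0F (inj₁ refl)))
  λ x → ≈-trans
    (+-cong (≈-trans (≈-sym (charPoly-cycle a b c d x))
        (≈-trans (≈-sym (charPoly-cong {x} (S_L⇒laplacian {G = C₄} {A} A∈S_L (S_L-C₄⇒cycle A∈S_L)))) (spectrum x)))
      (≈-refl { - target x}))
    (pointwise λ n → ℚ.+-inverseʳ (seq (target x) n))
  where
  a b c d : ℝ
  a = - A 0F 1F
  b = - A 1F 2F
  c = - A 2F 3F
  d = - A 3F 0F
  target : ℝ → ℝ
  target = Expressions.target ℝ-rawRing ev μ
  weight : ∀ i j → Adj C₄ i j → 0ℝ < - A i j
  weight i j adj = neg-pos (S_L.edge A∈S_L i j adj)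

≥⇒realizable : ∀ ev μ → 0ℝ < ev → 2ℝ * ev ≤ μ → LaplacianRealizable C₄ (0ℝ ∷ ev ∷ ev ∷ μ ∷ [])
-- Equal weights b = d make u = 0, so Q = ev splits off as an eigenvalue. The block [[P+Q, v],
-- [v, P]] has eigenvalues ev and μ exactly when P = μ/2 and v² = μ(μ - 2ev)/4.
≥⇒realizable ev μ 0<ev 2ev≤μ = laplacian (cycle a b c b) ,
  cycle∈S_L (*-pos-ℝ 0<¼ 0<μ+r) 0<b (*-pos-ℝ 0<¼ 0<μ-r) 0<b , spectrum
  where
  ev≤μ-ev : ev ≤ μ - ev
  ev≤μ-ev = ≤-shift 2ev≤μ λ n →
    solve 2 (λ l m → m :- con (1ℚ ℚ.+ 1ℚ) :* l := m :- l :- l) refl (seq ev n) (seq μ n)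

  0≤disc : 0ℝ ≤ μ * (μ - 2ℝ * ev)
  0≤disc = *-nonneg-ℝ
    (≤-trans (≤-trans (<⇒≤ 0<ev) ev≤μ-ev)
      (≤-shift (<⇒≤ 0<ev) λ n → solve 2 (λ l m → l :- con 0ℚ := m :- (m :- l)) refl (seq ev n) (seq μ n)))
    (≤-shift 2ev≤μ λ n → solve 2 (λ l m → m :- con (1ℚ ℚ.+ 1ℚ) :* l := m :- con (1ℚ ℚ.+ 1ℚ) :* l :- con 0ℚ) refl (seq ev n) (seq μ n))

  √disc = sqrt 0≤disc
  r : ℝ
  r = proj₁ √disc
  0≤r : 0ℝ ≤ r
  0≤r = proj₁ (proj₂ √disc)
  r²≈disc : r * r ≈ μ * (μ - 2ℝ * ev)
  r²≈disc = proj₂ (proj₂ √disc)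

  disc-r²≈0 : μ * (μ - 2ℝ * ev) - r * r ≈ 0ℝ
  disc-r²≈0 = ≈-trans (+-cong (≈-sym r²≈disc) (≈-refl { - (r * r)})) (pointwise λ n → ℚ.+-inverseʳ (seq (r * r) n))

  t : ℝ
  t = μ - ev + r

  0<t : 0ℝ < t
  0<t = <-≤-trans 0<ev (≤-trans ev≤μ-ev (x≤x+y {r} {μ - ev} 0≤r))

  -- The gap is (μ - ev)² - r² ≈ ev², since (μ - ev)² = μ(μ - 2ev) + ev². Cancelling `t` then keeps
  -- r at least ev below μ, which makes the weight `c` positive.
  t*r≤ : t * r ≤ t * (μ - ev)
  t*r≤ = ≤-trans {y = t * r + ev * ev}
    (x≤x+y {ev * ev} {t * r} (pointwise-≤ λ n → square-nonneg (seq ev n)))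
    (≈⇒≤ (≈-sym (≈-trans {y = t * r + ev * ev + (μ * (μ - 2ℝ * ev) - r * r)}
      (pointwise λ n → solve 3 (λ l m r → (m :- l :+ r) :* (m :- l)
          := (m :- l :+ r) :* r :+ l :* l :+ (m :* (m :- con (1ℚ ℚ.+ 1ℚ) :* l) :- r :* r))
        refl (seq ev n) (seq μ n) (seq r n))
      (≈-trans (+-cong (≈-refl {t * r + ev * ev}) disc-r²≈0) (pointwise λ n → ℚ.+-identityʳ (seq (t * r + ev * ev) n))))))

  r≤μ-ev : r ≤ μ - ev
  r≤μ-ev = *-cancelˡ-≤ 0<t t*r≤

  0<μ-r : 0ℝ < μ - r
  0<μ-r = <-≤-trans 0<ev (≤-shift r≤μ-ev λ n →
    solve 3 (λ l m r → m :- l :- r := m :- r :- l) refl (seq ev n) (seq μ n) (seq r n))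

  0<μ+r : 0ℝ < μ + r
  0<μ+r = <-≤-trans 0<μ-r (≤-shift (+-mono-≤ 0≤r 0≤r) λ n →
    solve 2 (λ m r → r :+ r :- (con 0ℚ :+ con 0ℚ) := m :+ r :- (m :- r)) refl (seq μ n) (seq r n))

  a b c : ℝ
  a = fromℚ (½ ℚ.* ½) * (μ + r)
  b = fromℚ ½ * ev
  c = fromℚ (½ ℚ.* ½) * (μ - r)

  -- Strict order on reals asks for a gap that is itself strictly exceeded; half of the constant
  -- serves.
  fromℚ-pos : ∀ q → 0ℚ ℚ.< q → 0ℝ < fromℚ (q ℚ.+ q)
  fromℚ-pos q 0<q = mk< (q , 0<q , always λ n → ℚ.+-monoˡ-< q 0<q)

  0<¼ : 0ℝ < fromℚ (½ ℚ.* ½)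
  0<¼ = fromℚ-pos (½ ℚ.* (½ ℚ.* ½)) (ℚ.positive⁻¹ (½ ℚ.* (½ ℚ.* ½)))

  0<b : 0ℝ < b
  0<b = *-pos-ℝ (fromℚ-pos (½ ℚ.* ½) (ℚ.positive⁻¹ (½ ℚ.* ½))) 0<ev

  spectrum : IsSpectrum (0ℝ ∷ ev ∷ ev ∷ μ ∷ []) (laplacian (cycle a b c b))
  spectrum x = ≈-trans (charPoly-cycle a b c b x)
    -- As polynomials in r, the two sides differ by `k` times the defining relation of the square
    -- root.
    (≈-trans {y = target + k * (μ * (μ - 2ℝ * ev) - r * r)}
      (pointwise λ n → solve 4 (λ l m r x →
        let a = con (½ ℚ.* ½) :* (m :+ r) ; b = con ½ :* l ; c = con (½ ℚ.* ½) :* (m :- r) in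
        x :* Poly.cubic (a :+ c) (b :+ b) (b :- b) (a :- c) x
          := Poly.target l m x
             :+ con (½ ℚ.* ½) :* (x :* (x :- l)) :* (m :* (m :- con (1ℚ ℚ.+ 1ℚ) :* l) :- r :* r))
        refl (seq ev n) (seq μ n) (seq r n) (seq x n))
      (≈-trans (+-cong (≈-refl {target}) (*-congˡ {x = k} disc-r²≈0))
        (pointwise λ n → solve 2 (λ t k → t :+ k :* con 0ℚ := t) refl (seq target n) (seq k n))))
    where
    target k : ℝ
    target = Expressions.target ℝ-rawRing ev μ x
    k = fromℚ (½ ℚ.* ½) * (x * (x - ev))

theorem3p14 : (ev μ : ℝ) → 0ℝ < ev →
    LaplacianRealizable C₄ (0ℝ ∷ ev ∷ ev ∷ μ ∷ []) ⇔ μ ≥ 2ℝ * ev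
theorem3p14 ev μ 0<ev = mk⇔ (realizable⇒≥ ev μ) (≥⇒realizable ev μ 0<ev)
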